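{- Let $\Omega$ be a finite set and let $G\le\operatorname{Sym}(\Omega)$ be a transitive permutation group whose point stabilizers have order $2$ and which admits a subgroup $R\le G$ acting regularly on $\Omega$. Then the orbital scheme $\mathfrak{X}$ of $G$ is triply transitive.
   Context: An association scheme $\mathfrak{X}=(\Omega,\mathcal{R})$ consists of a finite set $\Omega$ and a set $\mathcal{R}=\{R_0,\ldots,R_d\}$ of (nonempty) relations on $\Omega$ with $R_0=\{(\omega,\omega):\omega\in\Omega\}$ such that: $\mathcal{R}$ is a partition of $\Omega\times\Omega$; for every $i$ the relation $R_i^*=\{(v,u):(u,v)\in R_i\}$ is in $\mathcal{R}$; and for all $0\le i,j,k\le d$ there is an integer $p_{ij}^k\ge 0$ such that $|\{w\in\Omega:(u,w)\in R_i,\ (w,v)\in R_j\}|=p_{ij}^k$ for every $(u,v)\in R_k$. (Commutativity is not assumed.) The orbital scheme of a transitive group $G\le\operatorname{Sym}(\Omega)$ is the association scheme whose relations are the orbitals of $G$, i.e. the orbits of $G$ on $\Omega\times\Omega$. $\operatorname{Aut}(\mathfrak{X})$ is the group of permutations of $\Omega$ preserving every $R_i$. Fix $v\in\Omega$ and let $\operatorname{Aut}(\mathfrak{X})_v$ be the stabilizer of $v$ in $\operatorname{Aut}(\mathfrak{X})$. Let $A_i$ be the $0/1$ adjacency matrix of $R_i$ and let $E_i^*$ be the diagonal matrix with $E_i^*(u,u)=1$ if $(v,u)\in R_i$ and $0$ otherwise. Inside the matrix algebra $\operatorname{M}_\Omega(\mathbb{C})$ put: $T_0=\operatorname{Span}\{E_i^*A_jE_k^*:0\le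 i,j,k\le d\}$; $T$ the algebra generated by $A_0,\ldots,A_d,E_0^*,\ldots,E_d^*$ (the Terwilliger algebra); and $\tilde T$ the algebra of all matrices commuting with all permutation matrices of elements of $\operatorname{Aut}(\mathfrak{X})_v$. One has $T_0\subseteq T\subseteq\tilde T$, and when $\operatorname{Aut}(\mathfrak{X})$ is transitive these depend on $v$ only up to isomorphism. The scheme $\mathfrak{X}$ is triply transitive if $\operatorname{Aut}(\mathfrak{X})$ is transitive on $\Omega$ and $T_0=T=\tilde T$. -}

module Defs where

open import Algebra.Bundles using (CommutativeRing)
open import Data.Bool.Base using (if_then_else_)
open import Data.Fin.Base using (Fin; zero; suc)
import Data.Fin.Properties as Fin
open import Data.Fin.Permutation as Perm using (Permutation′; _⟨$⟩ʳ_; _∘ₚ_)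
open import Data.List.Base using (length; filter; allFin)
open import Data.Nat.Base as ℕ using (ℕ; suc)
import Data.Nat.Properties as ℕ
open import Data.Product.Base using (_×_; _,_; proj₁; proj₂; ∃; ∃₂)
open import Data.Product using (∃!)
open import Data.Rational.Base using (ℚ; 0ℚ; 1ℚ; ½; Positive; positive)
import Data.Rational.Base as ℚ
import Data.Rational.Properties as ℚ
open import Data.Sum.Base using ([_,_])
open import Function.Bundles using (Inverse; _⇔_; mk⇔)
open import Function.Construct.Composition using (_⇔-∘_)
open import Function.Construct.Symmetry using (⇔-sym)
open import Level using (0ℓ)
open import Relation.Binary.Bundles using (Setoid)
open import Relation.Binary.Core using (Rel)
open import Relation.Binary.Definitions using (Decidable)
open import Relation.Binary.PropositionalEquality using (_≡_; refl; sym; trans; cong; cong₂; subst; subst₂; setoid)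
open import Relation.Nullary.Decidable using (Dec; does; _×-dec_; map′)
open import Relation.Unary using (Pred; _∈_; _≐_)

module Real where

  infix 4 _~_

  -- For Cauchy sequences this says that the difference tends to 0, and
  -- x ~ x says that x is a Cauchy sequence.
  _~_ : Rel (ℕ → ℚ) 0ℓ
  x ~ y = ∀ ε → 0ℚ ℚ.< ε → ∃ λ N → ∀ {m n} → N ℕ.≤ m → N ℕ.≤ n →
          ℚ.∣ x m ℚ.- y n ∣ ℚ.< ε

  record ℝ : Set where
    constructor mkℝ
    field
      seq    : ℕ → ℚ
      cauchy : seq ~ seq

  open ℝ public

  infix 4 _≈_

  _≈_ : Rel ℝ 0ℓ
  x ≈ y = seq x ~ seq y

  private
    open import Algebra.Properties.Ring ℚ.+-*-ring
      using (⁻¹-anti-homo-//; //-rightDividesˡ; x[y-z]≈xy-xz; [y-z]x≈yx-zx)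
    open import Algebra.Properties.CommutativeSemigroup
      (CommutativeRing.+-commutativeSemigroup ℚ.+-*-commutativeRing) using (interchange)

    telescope : ∀ a b c → a ℚ.- c ≡ (a ℚ.- b) ℚ.+ (b ℚ.- c)
    telescope a b c =
      trans (cong (ℚ._- c) (sym (//-rightDividesˡ b a))) (ℚ.+-assoc (a ℚ.- b) b (ℚ.- c))

    sum-difference : ∀ a b c d →
                     (a ℚ.+ b) ℚ.- (c ℚ.+ d) ≡ (a ℚ.- c) ℚ.+ (b ℚ.- d)
    sum-difference a b c d =
      trans (cong (a ℚ.+ b ℚ.+_) (ℚ.neg-distrib-+ c d)) (interchange a b (ℚ.- c) (ℚ.- d))

    product-difference : ∀ a b c d →
                         (a ℚ.* b) ℚ.- (c ℚ.* d) ≡ a ℚ.* (b ℚ.- d) ℚ.+ d ℚ.* (a ℚ.- c)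
    product-difference a b c d =
      trans (telescope (a ℚ.* b) (a ℚ.* d) (c ℚ.* d))
        (cong₂ ℚ._+_ (sym (x[y-z]≈xy-xz a b d))
          (trans (sym ([y-z]x≈yx-zx d a c)) (ℚ.*-comm (a ℚ.- c) d)))

    ½-pos : ∀ {ε} → 0ℚ ℚ.< ε → 0ℚ ℚ.< ε ℚ.* ½
    ½-pos {ε} 0<ε = subst (ℚ._< ε ℚ.* ½) (ℚ.*-zeroˡ ½) (ℚ.*-monoˡ-<-pos ½ 0<ε)

    halves : ∀ ε → ε ℚ.* ½ ℚ.+ ε ℚ.* ½ ≡ ε
    halves ε = trans (sym (ℚ.*-distribˡ-+ ε ½ ½)) (ℚ.*-identityʳ ε)

    add-< : ∀ {p q r ε} → p ≡ q ℚ.+ r →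
            ℚ.∣ q ∣ ℚ.< ε ℚ.* ½ → ℚ.∣ r ∣ ℚ.< ε ℚ.* ½ → ℚ.∣ p ∣ ℚ.< ε
    add-< {q = q} {r} {ε} refl q< r< =
      ℚ.≤-<-trans (ℚ.∣p+q∣≤∣p∣+∣q∣ q r)
        (subst (ℚ.∣ q ∣ ℚ.+ ℚ.∣ r ∣ ℚ.<_) (halves ε) (ℚ.+-mono-< q< r<))

    left : ∀ {M N k} → M ℕ.⊔ N ℕ.≤ k → M ℕ.≤ k
    left {M} {N} = ℕ.≤-trans (ℕ.m≤m⊔n M N)

    right : ∀ {M N k} → M ℕ.⊔ N ℕ.≤ k → N ℕ.≤ k
    right {M} {N} = ℕ.≤-trans (ℕ.m≤n⊔m M N)

    ~-sym : ∀ {x y} → x ~ y → y ~ x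
    ~-sym {x} {y} x~y ε 0<ε with x~y ε 0<ε
    ... | N , close = N , λ {m} {n} N≤m N≤n →
      subst (ℚ._< ε)
        (trans (sym (ℚ.∣-p∣≡∣p∣ (x n ℚ.- y m)))
               (cong ℚ.∣_∣ (⁻¹-anti-homo-// (x n) (y m))))
        (close N≤n N≤m)

    ~-trans : ∀ {x y z} → x ~ y → y ~ z → x ~ z
    ~-trans {x} {y} {z} x~y y~z ε 0<ε
      with x~y (ε ℚ.* ½) (½-pos 0<ε) | y~z (ε ℚ.* ½) (½-pos 0<ε)
    ... | M , x-y | N , y-z = M ℕ.⊔ N , λ {m} {n} ≤m ≤n →
      add-< (telescope (x m) (y (M ℕ.⊔ N)) (z n))
        (x-y (left {M} ≤m) (ℕ.m≤m⊔n M N)) (y-z (ℕ.m≤n⊔m M N) (right {M} ≤n))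

    +-resp : ∀ {x x′ y y′} → x ~ x′ → y ~ y′ →
             (λ n → x n ℚ.+ y n) ~ (λ n → x′ n ℚ.+ y′ n)
    +-resp {x} {x′} {y} {y′} x~x′ y~y′ ε 0<ε
      with x~x′ (ε ℚ.* ½) (½-pos 0<ε) | y~y′ (ε ℚ.* ½) (½-pos 0<ε)
    ... | M , dx | N , dy = M ℕ.⊔ N , λ {m} {n} ≤m ≤n →
      add-< (sum-difference (x m) (y m) (x′ n) (y′ n))
        (dx (left {M} ≤m) (left {M} ≤n)) (dy (right {M} ≤m) (right {M} ≤n))

    neg-resp : ∀ {x x′} → x ~ x′ → (λ n → ℚ.- x n) ~ (λ n → ℚ.- x′ n)
    neg-resp {x} {x′} x~x′ ε 0<ε with x~x′ ε 0<ε
    ... | N , close = N , λ {m} {n} N≤m N≤n →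
      subst (ℚ._< ε)
        (trans (sym (ℚ.∣-p∣≡∣p∣ (x m ℚ.- x′ n)))
               (cong ℚ.∣_∣ (ℚ.neg-distrib-+ (x m) (ℚ.- x′ n))))
        (close N≤m N≤n)

    bounded : ∀ {x} → x ~ x →
              ∃ λ B → Positive B × ∃ λ N → ∀ {n} → N ℕ.≤ n → ℚ.∣ x n ∣ ℚ.≤ B
    bounded {x} x~x with x~x 1ℚ (ℚ.positive⁻¹ 1ℚ)
    ... | N , close = 1ℚ ℚ.+ ℚ.∣ x N ∣ ,
      positive (ℚ.+-mono-<-≤ (ℚ.positive⁻¹ 1ℚ) (ℚ.0≤∣p∣ (x N))) ,
      N , λ {n} N≤n →
        ℚ.≤-trans
          (subst (λ a → ℚ.∣ a ∣ ℚ.≤ ℚ.∣ x n ℚ.- x N ∣ ℚ.+ ℚ.∣ x N ∣)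
            (//-rightDividesˡ (x N) (x n))
            (ℚ.∣p+q∣≤∣p∣+∣q∣ (x n ℚ.- x N) (x N)))
          (ℚ.+-monoˡ-≤ ℚ.∣ x N ∣ (ℚ.<⇒≤ (close N≤n ℕ.≤-refl)))

    quotient : ∀ B → Positive B → ∀ {ε} → 0ℚ ℚ.< ε →
               ∃ λ δ → 0ℚ ℚ.< δ × B ℚ.* δ ≡ ε
    quotient B B>0 {ε} 0<ε = (ℚ.1/ B) ℚ.* ε ,
      subst (ℚ._< (ℚ.1/ B) ℚ.* ε) (ℚ.*-zeroʳ (ℚ.1/ B)) (ℚ.*-monoʳ-<-pos (ℚ.1/ B) 0<ε) ,
      trans (sym (ℚ.*-assoc B (ℚ.1/ B) ε))
        (trans (cong (ℚ._* ε) (ℚ.*-inverseʳ B)) (ℚ.*-identityˡ ε))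
      where
      instance
        B-pos : Positive B
        B-pos = B>0
        B≢0 : ℚ.NonZero B
        B≢0 = ℚ.pos⇒nonZero B
        1/B-pos : Positive (ℚ.1/ B)
        1/B-pos = ℚ.1/pos⇒pos B

    mul-< : ∀ B → Positive B → ∀ {δ ε a b} → B ℚ.* δ ≡ ε →
            ℚ.∣ a ∣ ℚ.≤ B → ℚ.∣ b ∣ ℚ.< δ → ℚ.∣ a ℚ.* b ∣ ℚ.< ε
    mul-< B B>0 {δ} {a = a} {b} refl a≤B b<δ =
      subst (ℚ._< B ℚ.* δ) (sym (ℚ.∣p*q∣≡∣p∣*∣q∣ a b))
        (ℚ.≤-<-trans
          (ℚ.*-monoʳ-≤-nonNeg ℚ.∣ b ∣ {{ℚ.nonNegative (ℚ.0≤∣p∣ b)}} a≤B)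
          (ℚ.*-monoʳ-<-pos B {{B>0}} b<δ))

    *-resp : ∀ {x x′ y y′} → x ~ x → y′ ~ y′ → x ~ x′ → y ~ y′ →
             (λ n → x n ℚ.* y n) ~ (λ n → x′ n ℚ.* y′ n)
    *-resp {x} {x′} {y} {y′} x~x y′~y′ x~x′ y~y′ ε 0<ε
      with bounded {x} x~x | bounded {y′} y′~y′
    ... | B , B>0 , K , x≤B | C , C>0 , L , y′≤C
      with quotient B B>0 (½-pos 0<ε) | quotient C C>0 (½-pos 0<ε)
    ... | δ , 0<δ , Bδ | η , 0<η , Cη
      with y~y′ δ 0<δ | x~x′ η 0<η
    ... | M , dy | N , dx = (K ℕ.⊔ L) ℕ.⊔ (M ℕ.⊔ N) , λ {m} {n} ≤m ≤n →
      add-< (product-difference (x m) (y m) (x′ n) (y′ n))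
        (mul-< B B>0 Bδ (x≤B (left {K} (left {K ℕ.⊔ L} ≤m)))
          (dy (left {M} (right {K ℕ.⊔ L} ≤m)) (left {M} (right {K ℕ.⊔ L} ≤n))))
        (mul-< C C>0 Cη (y′≤C (right {K} (left {K ℕ.⊔ L} ≤n)))
          (dx (right {M} (right {K ℕ.⊔ L} ≤m)) (right {M} (right {K ℕ.⊔ L} ≤n))))

    const-cauchy : ∀ q → (λ _ → q) ~ (λ _ → q)
    const-cauchy q ε 0<ε = 0 , λ _ _ → subst (λ a → ℚ.∣ a ∣ ℚ.< ε) (sym (ℚ.+-inverseʳ q)) 0<ε

    pointwise : ∀ {x y : ℝ} → (∀ n → seq x n ≡ seq y n) → x ≈ y
    pointwise {x} x≗y ε 0<ε with cauchy x ε 0<ε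
    ... | N , close = N , λ {m} {n} N≤m N≤n →
      subst (λ a → ℚ.∣ seq x m ℚ.- a ∣ ℚ.< ε) (x≗y n) (close N≤m N≤n)

  infixl 6 _+_
  infixl 7 _*_
  infix  8 -_

  _+_ _*_ : ℝ → ℝ → ℝ
  x + y = mkℝ (λ n → seq x n ℚ.+ seq y n)
              (+-resp {seq x} {seq x} {seq y} {seq y} (cauchy x) (cauchy y))
  x * y = mkℝ (λ n → seq x n ℚ.* seq y n)
              (*-resp {seq x} {seq x} {seq y} {seq y} (cauchy x) (cauchy y) (cauchy x) (cauchy y))

  -_ : ℝ → ℝ
  - x = mkℝ (λ n → ℚ.- seq x n) (neg-resp {seq x} {seq x} (cauchy x))

  0ℝ 1ℝ : ℝ
  0ℝ = mkℝ (λ _ → 0ℚ) (const-cauchy 0ℚ)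
  1ℝ = mkℝ (λ _ → 1ℚ) (const-cauchy 1ℚ)

  +-*-commutativeRing : CommutativeRing 0ℓ 0ℓ
  +-*-commutativeRing = record
    { Carrier = ℝ ; _≈_ = _≈_ ; _+_ = _+_ ; _*_ = _*_ ; -_ = -_ ; 0# = 0ℝ ; 1# = 1ℝ
    ; isCommutativeRing = record
      { isRing = record
        { +-isAbelianGroup = record
          { isGroup = record
            { isMonoid = record
              { isSemigroup = record
                { isMagma = record
                  { isEquivalence = record
                    { refl  = λ {x} → cauchy x
                    ; sym   = λ {x} {y} → ~-sym {seq x} {seq y}
                    ; trans = λ {x} {y} {z} → ~-trans {seq x} {seq y} {seq z}
                    }
                  ; ∙-cong = λ {x} {x′} {y} {y′} → +-resp {seq x} {seq x′} {seq y} {seq y′}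
                  }
                ; assoc = λ x y z → pointwise {(x + y) + z} {x + (y + z)}
                    λ n → ℚ.+-assoc (seq x n) (seq y n) (seq z n)
                }
              ; identity = (λ x → pointwise {0ℝ + x} {x} λ n → ℚ.+-identityˡ (seq x n))
                         , (λ x → pointwise {x + 0ℝ} {x} λ n → ℚ.+-identityʳ (seq x n))
              }
            ; inverse = (λ x → pointwise {(- x) + x} {0ℝ} λ n → ℚ.+-inverseˡ (seq x n))
                      , (λ x → pointwise {x + (- x)} {0ℝ} λ n → ℚ.+-inverseʳ (seq x n))
            ; ⁻¹-cong = λ {x} {y} → neg-resp {seq x} {seq y}
            }
          ; comm = λ x y → pointwise {x + y} {y + x} λ n → ℚ.+-comm (seq x n) (seq y n)
          }
        ; *-cong = λ {x} {x′} {y} {y′} →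
            *-resp {seq x} {seq x′} {seq y} {seq y′} (cauchy x) (cauchy y′)
        ; *-assoc = λ x y z → pointwise {(x * y) * z} {x * (y * z)}
            λ n → ℚ.*-assoc (seq x n) (seq y n) (seq z n)
        ; *-identity = (λ x → pointwise {1ℝ * x} {x} λ n → ℚ.*-identityˡ (seq x n))
                     , (λ x → pointwise {x * 1ℝ} {x} λ n → ℚ.*-identityʳ (seq x n))
        ; distrib = (λ x y z → pointwise {x * (y + z)} {x * y + x * z}
                       λ n → ℚ.*-distribˡ-+ (seq x n) (seq y n) (seq z n))
                  , (λ x y z → pointwise {(y + z) * x} {y * x + z * x}
                       λ n → ℚ.*-distribʳ-+ (seq x n) (seq y n) (seq z n))
        }
      ; *-comm = λ x y → pointwise {x * y} {y * x} λ n → ℚ.*-comm (seq x n) (seq y n)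
      }
    }

-- The ring R[x]/(x² + 1).
module AdjoinI {c ℓ} (R : CommutativeRing c ℓ) where

  private
    module R = CommutativeRing R
    open import Algebra.Properties.Ring R.ring using (-0#≈0#; -1*x≈-x)

  infixl 6 _+_
  infixl 7 _*_
  infix  8 -_
  infix  4 _≈_
  infix  5 _+i_

  record R[i] : Set c where
    constructor _+i_
    field
      re im : R.Carrier

  open R[i] public

  _≈_ : Rel R[i] ℓ
  z ≈ w = re z R.≈ re w × im z R.≈ im w

  _+_ _*_ : R[i] → R[i] → R[i]
  z + w = re z R.+ re w +i im z R.+ im w
  z * w = re z R.* re w R.- im z R.* im w +i re z R.* im w R.+ im z R.* re w

  -_ : R[i] → R[i]
  - z = R.- re z +i R.- im z

  0# 1# : R[i]
  0# = R.0# +i R.0#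
  1# = R.1# +i R.0#

  private
    -1# : R.Carrier
    -1# = R.- R.1#

    minus : ∀ {x x′ y y′} → x R.≈ x′ → y R.≈ y′ → x R.- y R.≈ x′ R.+ -1# R.* y′
    minus {y′ = y′} p q = R.+-cong p (R.trans (R.-‿cong q) (R.sym (-1*x≈-x y′)))

    module Solve where
      open import Algebra.Solver.Ring.NaturalCoefficients.Default R.commutativeSemiring

      assoc-re : ∀ s a b c d e f →
        (a R.* c R.+ s R.* (b R.* d)) R.* e R.+ s R.* ((a R.* d R.+ b R.* c) R.* f) R.≈
        a R.* (c R.* e R.+ s R.* (d R.* f)) R.+ s R.* (b R.* (c R.* f R.+ d R.* e))
      assoc-re = solve 7 (λ s a b c d e f →
        ((a :* c :+ s :* (b :* d)) :* e :+ s :* ((a :* d :+ b :* c) :* f)) :=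
        (a :* (c :* e :+ s :* (d :* f)) :+ s :* (b :* (c :* f :+ d :* e)))) R.refl

      assoc-im : ∀ s a b c d e f →
        (a R.* c R.+ s R.* (b R.* d)) R.* f R.+ (a R.* d R.+ b R.* c) R.* e R.≈
        a R.* (c R.* f R.+ d R.* e) R.+ b R.* (c R.* e R.+ s R.* (d R.* f))
      assoc-im = solve 7 (λ s a b c d e f →
        ((a :* c :+ s :* (b :* d)) :* f :+ (a :* d :+ b :* c) :* e) :=
        (a :* (c :* f :+ d :* e) :+ b :* (c :* e :+ s :* (d :* f)))) R.refl

      distrib-re : ∀ s a b c d e f →
        a R.* (c R.+ e) R.+ s R.* (b R.* (d R.+ f)) R.≈
        (a R.* c R.+ s R.* (b R.* d)) R.+ (a R.* e R.+ s R.* (b R.* f))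
      distrib-re = solve 7 (λ s a b c d e f →
        (a :* (c :+ e) :+ s :* (b :* (d :+ f))) :=
        ((a :* c :+ s :* (b :* d)) :+ (a :* e :+ s :* (b :* f)))) R.refl

      distrib-im : ∀ a b c d e f →
        a R.* (d R.+ f) R.+ b R.* (c R.+ e) R.≈
        (a R.* d R.+ b R.* c) R.+ (a R.* f R.+ b R.* e)
      distrib-im = solve 6 (λ a b c d e f →
        (a :* (d :+ f) :+ b :* (c :+ e)) :=
        ((a :* d :+ b :* c) :+ (a :* f :+ b :* e))) R.refl

    re-* : ∀ a b c d → a R.* c R.- b R.* d R.≈ a R.* c R.+ -1# R.* (b R.* d)
    re-* a b c d = minus R.refl R.refl

    *-assoc : ∀ x y z → (x * y) * z ≈ x * (y * z)
    *-assoc (a +i b) (c +i d) (e +i f) =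
      R.trans (minus (R.*-congʳ (re-* a b c d)) R.refl)
        (R.trans (Solve.assoc-re -1# a b c d e f)
          (R.sym (minus (R.*-congˡ (re-* c d e f)) R.refl))) ,
      R.trans (R.+-congʳ (R.*-congʳ (re-* a b c d)))
        (R.trans (Solve.assoc-im -1# a b c d e f)
          (R.sym (R.+-congˡ (R.*-congˡ (re-* c d e f)))))

    *-cong : ∀ {x y u v} → x ≈ y → u ≈ v → x * u ≈ y * v
    *-cong (p , q) (r , s) =
      R.+-cong (R.*-cong p r) (R.-‿cong (R.*-cong q s)) ,
      R.+-cong (R.*-cong p s) (R.*-cong q r)

    *-comm : ∀ x y → x * y ≈ y * x
    *-comm (a +i b) (c +i d) =
      R.+-cong (R.*-comm a c) (R.-‿cong (R.*-comm b d)) ,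
      R.trans (R.+-cong (R.*-comm a d) (R.*-comm b c)) (R.+-comm _ _)

    *-identityˡ : ∀ x → 1# * x ≈ x
    *-identityˡ (a +i b) =
      R.trans (R.+-cong (R.*-identityˡ a) (R.trans (R.-‿cong (R.zeroˡ b)) -0#≈0#)) (R.+-identityʳ a) ,
      R.trans (R.+-cong (R.*-identityˡ b) (R.zeroˡ a)) (R.+-identityʳ b)

    ≈-trans : ∀ {x y z} → x ≈ y → y ≈ z → x ≈ z
    ≈-trans (p , q) (r , s) = R.trans p r , R.trans q s

    distribˡ : ∀ x y z → x * (y + z) ≈ x * y + x * z
    distribˡ (a +i b) (c +i d) (e +i f) =
      R.trans (minus R.refl R.refl)
        (R.trans (Solve.distrib-re -1# a b c d e f)
          (R.sym (R.+-cong (re-* a b c d) (re-* a b e f)))) ,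
      Solve.distrib-im a b c d e f

    +-cong : ∀ {x y u v} → x ≈ y → u ≈ v → x + u ≈ y + v
    +-cong (p , q) (r , s) = R.+-cong p r , R.+-cong q s

  commutativeRing : CommutativeRing c ℓ
  commutativeRing = record
    { Carrier = R[i] ; _≈_ = _≈_ ; _+_ = _+_ ; _*_ = _*_ ; -_ = -_ ; 0# = 0# ; 1# = 1#
    ; isCommutativeRing = record
      { isRing = record
        { +-isAbelianGroup = record
          { isGroup = record
            { isMonoid = record
              { isSemigroup = record
                { isMagma = record
                  { isEquivalence = record
                    { refl  = R.refl , R.refl
                    ; sym   = λ (p , q) → R.sym p , R.sym q
                    ; trans = ≈-trans
                    }
                  ; ∙-cong = +-cong
                  }
                ; assoc = λ x y z → R.+-assoc (re x) (re y) (re z) , R.+-assoc (im x) (im y) (im z)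
                }
              ; identity = (λ x → R.+-identityˡ (re x) , R.+-identityˡ (im x))
                         , (λ x → R.+-identityʳ (re x) , R.+-identityʳ (im x))
              }
            ; inverse = (λ x → R.-‿inverseˡ (re x) , R.-‿inverseˡ (im x))
                      , (λ x → R.-‿inverseʳ (re x) , R.-‿inverseʳ (im x))
            ; ⁻¹-cong = λ (p , q) → R.-‿cong p , R.-‿cong q
            }
          ; comm = λ x y → R.+-comm (re x) (re y) , R.+-comm (im x) (im y)
          }
        ; *-cong = *-cong
        ; *-assoc = *-assoc
        ; *-identity = *-identityˡ , (λ x → ≈-trans (*-comm x 1#) (*-identityˡ x))
        ; distrib = distribˡ
                  , (λ x y z → ≈-trans (*-comm (y + z) x)
                      (≈-trans (distribˡ x y z) (+-cong (*-comm x y) (*-comm x z))))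
        }
      ; *-comm = *-comm
      }
    }

ℂ-commutativeRing : CommutativeRing 0ℓ 0ℓ
ℂ-commutativeRing = AdjoinI.commutativeRing Real.+-*-commutativeRing

module ℂ = CommutativeRing ℂ-commutativeRing

open ℂ using () renaming (Carrier to ℂ)
open import Algebra.Properties.Semiring.Sum ℂ.semiring using (sum)

indicator : ∀ {p} {P : Set p} → Dec P → ℂ
indicator P? = if does P? then ℂ.1# else ℂ.0#

record Subgroup (n : ℕ) : Set₁ where
  field
    Carrier   : Pred (Permutation′ n) 0ℓ
    resp      : ∀ {g h} → g Perm.≈ h → g ∈ Carrier → h ∈ Carrier
    id-closed : Perm.id ∈ Carrier
    ∘-closed  : ∀ {g h} → g ∈ Carrier → h ∈ Carrier → (g ∘ₚ h) ∈ Carrier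
    ⁻¹-closed : ∀ {g} → g ∈ Carrier → Perm.flip g ∈ Carrier

  elements : Setoid 0ℓ 0ℓ
  elements = record
    { Carrier       = ∃ Carrier
    ; _≈_           = λ g h → proj₁ g Perm.≈ proj₁ h
    ; isEquivalence = record
      { refl  = λ _ → refl
      ; sym   = λ p x → sym (p x)
      ; trans = λ p q x → trans (p x) (q x)
      }
    }

module _ {n : ℕ} where

  infix 4 _∈ᴳ_ _≤ᴳ_

  _∈ᴳ_ : Permutation′ n → Subgroup n → Set
  g ∈ᴳ G = g ∈ Subgroup.Carrier G

  _≤ᴳ_ : Rel (Subgroup n) 0ℓ
  H ≤ᴳ G = ∀ {g} → g ∈ᴳ H → g ∈ᴳ G

  HasOrder : Subgroup n → ℕ → Set
  HasOrder G k = Inverse (setoid (Fin k)) (Subgroup.elements G)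

  Stabilizer : Subgroup n → Fin n → Subgroup n
  Stabilizer G v = record
    { Carrier   = λ g → g ∈ᴳ G × g ⟨$⟩ʳ v ≡ v
    ; resp      = λ g≈h (g∈G , gv≡v) → G.resp g≈h g∈G , trans (sym (g≈h v)) gv≡v
    ; id-closed = G.id-closed , refl
    ; ∘-closed  = λ {_} {h} (g∈G , gv≡v) (h∈G , hv≡v) →
        G.∘-closed g∈G h∈G , trans (cong (h ⟨$⟩ʳ_) gv≡v) hv≡v
    ; ⁻¹-closed = λ {g} (g∈G , gv≡v) →
        G.⁻¹-closed g∈G , trans (cong (Perm.flip g ⟨$⟩ʳ_) (sym gv≡v)) (Perm.inverseˡ g)
    }
    where module G = Subgroup G

  Transitive : Subgroup n → Set
  Transitive G = ∀ u v → ∃ λ g → g ∈ᴳ G × g ⟨$⟩ʳ u ≡ v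

  Regular : Subgroup n → Set
  Regular G = ∀ u v → ∃! Perm._≈_ λ g → g ∈ᴳ G × g ⟨$⟩ʳ u ≡ v

  -- The orbit of (u , v) under the action of G on pairs.
  Orbital : Subgroup n → Fin n → Fin n → Rel (Fin n) 0ℓ
  Orbital G u v u′ v′ = ∃ λ g → g ∈ᴳ G × g ⟨$⟩ʳ u ≡ u′ × g ⟨$⟩ʳ v ≡ v′

record AssociationScheme (n : ℕ) : Set₁ where
  field
    d         : ℕ
    R         : Fin (suc d) → Rel (Fin n) 0ℓ
    nonempty  : ∀ i → ∃₂ λ u v → R i u v
    diagonal  : ∀ {u v} → R zero u v ⇔ u ≡ v
    partition : ∀ u v → ∃! _≡_ λ i → R i u v
    converse  : ∀ i → ∃ λ i* → ∀ {u v} → R i* u v ⇔ R i v u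

  R? : ∀ i → Decidable (R i)
  R? i u v = let (j , Rj , unique) = partition u v in
    map′ (λ j≡i → subst (λ k → R k u v) j≡i Rj) unique (j Fin.≟ i)

  field
    p         : (i j k : Fin (suc d)) → ℕ
    p-correct : ∀ i j k {u v} → R k u v →
      length (filter (λ w → R? i u w ×-dec R? j w v) (allFin n)) ≡ p i j k

module _ {n : ℕ} where

  infix 4 _≈ᴿ_

  _≈ᴿ_ : Rel (Rel (Fin n) 0ℓ) 0ℓ
  S ≈ᴿ S′ = ∀ u v → S u v ⇔ S′ u v

  -- The relations of X are exactly the orbitals of G.  This determines X up
  -- to the numbering of the relations other than R zero.
  IsOrbitalScheme : Subgroup n → AssociationScheme n → Set
  IsOrbitalScheme G X =
    (∀ i → ∃₂ λ u v → R i ≈ᴿ Orbital G u v) ×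
    (∀ u v → ∃ λ i → R i ≈ᴿ Orbital G u v)
    where open AssociationScheme X

  Aut : AssociationScheme n → Subgroup n
  Aut X = record
    { Carrier   = λ g → ∀ i u v → R i u v ⇔ R i (g ⟨$⟩ʳ u) (g ⟨$⟩ʳ v)
    ; resp      = λ g≈h g∈ i u v →
        subst₂ (λ u′ v′ → R i u v ⇔ R i u′ v′) (g≈h u) (g≈h v) (g∈ i u v)
    ; id-closed = λ _ _ _ → mk⇔ (λ r → r) (λ r → r)
    ; ∘-closed  = λ {g} g∈ h∈ i u v →
        h∈ i (g ⟨$⟩ʳ u) (g ⟨$⟩ʳ v) ⇔-∘ g∈ i u v
    ; ⁻¹-closed = λ {g} g∈ i u v →
        ⇔-sym (subst₂ (λ u′ v′ → R i (Perm.flip g ⟨$⟩ʳ u) (Perm.flip g ⟨$⟩ʳ v) ⇔ R i u′ v′)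
          (Perm.inverseʳ g) (Perm.inverseʳ g) (g∈ i _ _))
    }
    where open AssociationScheme X

Matrix : ℕ → Set
Matrix n = Fin n → Fin n → ℂ

module _ {n : ℕ} where

  infix  4 _≈ᴹ_
  infixl 6 _+ᴹ_
  infixl 7 _*ᴹ_
  infixr 7 _*ₗ_

  _≈ᴹ_ : Rel (Matrix n) 0ℓ
  M ≈ᴹ N = ∀ u v → M u v ℂ.≈ N u v

  0ᴹ 1ᴹ : Matrix n
  0ᴹ u v = ℂ.0#
  1ᴹ u v = indicator (u Fin.≟ v)

  _+ᴹ_ _*ᴹ_ : Matrix n → Matrix n → Matrix n
  (M +ᴹ N) u v = M u v ℂ.+ N u v
  (M *ᴹ N) u v = sum λ w → M u w ℂ.* N w v

  _*ₗ_ : ℂ → Matrix n → Matrix n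
  (z *ₗ M) u v = z ℂ.* M u v

  -- Sends the basis vector at v to the basis vector at g v.
  permutationMatrix : Permutation′ n → Matrix n
  permutationMatrix g u v = indicator (u Fin.≟ g ⟨$⟩ʳ v)

  data Span {I : Set} (M : I → Matrix n) : Pred (Matrix n) 0ℓ where
    generator : ∀ i → M i ∈ Span M
    0-closed  : 0ᴹ ∈ Span M
    +-closed  : ∀ {N P} → N ∈ Span M → P ∈ Span M → (N +ᴹ P) ∈ Span M
    *ₗ-closed : ∀ z {N} → N ∈ Span M → (z *ₗ N) ∈ Span M
    resp      : ∀ {N P} → N ≈ᴹ P → N ∈ Span M → P ∈ Span M

  data Alg {I : Set} (M : I → Matrix n) : Pred (Matrix n) 0ℓ where
    generator : ∀ i → M i ∈ Alg M
    0-closed  : 0ᴹ ∈ Alg M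
    1-closed  : 1ᴹ ∈ Alg M
    +-closed  : ∀ {N P} → N ∈ Alg M → P ∈ Alg M → (N +ᴹ P) ∈ Alg M
    *-closed  : ∀ {N P} → N ∈ Alg M → P ∈ Alg M → (N *ᴹ P) ∈ Alg M
    *ₗ-closed : ∀ z {N} → N ∈ Alg M → (z *ₗ N) ∈ Alg M
    resp      : ∀ {N P} → N ≈ᴹ P → N ∈ Alg M → P ∈ Alg M

module _ {n : ℕ} (X : AssociationScheme n) where
  open AssociationScheme X

  A : Fin (suc d) → Matrix n
  A i u w = indicator (R? i u w)

  module _ (v : Fin n) where

    E* : Fin (suc d) → Matrix n
    E* i u w = indicator (u Fin.≟ w ×-dec R? i v u)

    T₀ : Pred (Matrix n) 0ℓ
    T₀ = Span {I = Fin (suc d) × Fin (suc d) × Fin (suc d)}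
              λ (i , j , k) → E* i *ᴹ A j *ᴹ E* k

    T : Pred (Matrix n) 0ℓ
    T = Alg [ A , E* ]

    T̃ : Pred (Matrix n) 0ℓ
    T̃ M = ∀ g → g ∈ᴳ Stabilizer (Aut X) v →
          permutationMatrix g *ᴹ M ≈ᴹ M *ᴹ permutationMatrix g

  -- All v : when Aut X is transitive, the equalities at one base point
  -- imply those at every other.
  TriplyTransitive : Set
  TriplyTransitive = Transitive (Aut X) × (∀ v → T₀ v ≐ T v × T v ≐ T̃ v)

{-# OPTIONS --safe #-}

-- The algebra T̃ consists of the matrices that are constant on the orbits of
-- Aut(X)_v on Ω × Ω, and T₀ is spanned by the indicator matrices of the sets
-- of pairs (u , w) for which (v , u), (u , w) and (v , w) lie in prescribed
-- relations.  So everything reduces to showing that two pairs (u , w) and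
-- (u′ , w′) of the same type lie in one orbit of G_v.  There are a, b ∈ G_v
-- with a u = u′ and b w = w′, and c ∈ G with c u = u′ and c w = w′.  If r ∈ R
-- takes v to c v, then h = r⁻¹ c lies in G_v too.  As |G_v| = 2, two of a, b, h
-- coincide.  If a = b, this element maps (u , w) to (u′ , w′).  If h = a, then
-- r fixes u′, and if h = b, then r fixes w′; either way r = 1 by regularity,
-- and so c = h ∈ G_v.

module Submission where

open import Defs
open import Algebra.Bundles using (CommutativeMonoid; CommutativeRing)
open import Data.Bool.Base using (if_then_else_)
open import Data.Nat.Base using (ℕ; suc; s<s)
open import Data.Nat.Properties using (≤-refl)
open import Data.Fin.Base using (Fin; zero; suc; punchIn; _<_)
open import Data.Fin.Patterns using (0F; 1F; 2F)
open import Data.Fin.Properties using (_≟_; any?; pigeonhole; punchInᵢ≢i)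
open import Data.Fin.Permutation as Perm using (Permutation′; _⟨$⟩ʳ_; _⟨$⟩ˡ_; _∘ₚ_)
open import Data.Product.Base using (_×_; _,_; proj₁; proj₂; ∃; ∃₂)
open import Data.Sum.Base as Sum using (inj₁; inj₂)
open import Data.Vec.Functional using (Vector)
open import Level using (0ℓ)
open import Function.Base using (_∘_)
open import Function.Bundles using (_⇔_; mk⇔; Equivalence; Inverse)
open import Function.Construct.Symmetry using (⇔-sym)
open import Relation.Binary.PropositionalEquality
  using (_≡_; _≢_; refl; sym; trans; cong; subst; subst₂)
open import Relation.Nullary.Decidable using (Dec; does; yes; no; _×-dec_)
open import Relation.Nullary.Negation using (¬_; contradiction)
open import Relation.Unary using (_∈_; _⊆_)

open Equivalence using (to; from)

-- Finite sums with a single nonzero term.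

module SumOverFin {c ℓ} (M : CommutativeMonoid c ℓ) where
  open CommutativeMonoid M renaming (refl to ≈-refl; trans to ≈-trans)
  open import Algebra.Properties.CommutativeMonoid.Sum M

  sum-zero : ∀ {n} {t : Vector Carrier n} → (∀ i → t i ≈ ε) → sum t ≈ ε
  sum-zero {n} t≈0 = ≈-trans (sum-cong-≋ t≈0) (sum-replicate-zero n)

  sum-single : ∀ {n} (t : Vector Carrier n) i → (∀ j → j ≢ i → t j ≈ ε) → sum t ≈ t i
  sum-single {suc n} t i t≈0 =
    ≈-trans (sum-remove {i = i} t)
      (≈-trans (∙-congˡ (sum-zero λ j → t≈0 (punchIn i j) (punchInᵢ≢i i j)))
        (identityʳ (t i)))

  -- The sums collapse from the outside in: a difference in one coordinate already makes the triples
  -- differ, so the one hypothesis serves all three stages.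
  sum-single₃ : ∀ {m n p} (t : Fin m → Fin n → Fin p → Carrier) i j k →
    (∀ i′ j′ k′ → (i′ , j′ , k′) ≢ (i , j , k) → t i′ j′ k′ ≈ ε) →
    sum (λ i′ → sum λ j′ → sum λ k′ → t i′ j′ k′) ≈ t i j k
  sum-single₃ t i j k t≈0 =
    ≈-trans
      (sum-single _ i λ i′ i′≢i → sum-zero λ j′ → sum-zero λ k′ →
        t≈0 i′ j′ k′ λ { refl → i′≢i refl })
      (≈-trans
        (sum-single _ j λ j′ j′≢j → sum-zero λ k′ → t≈0 i j′ k′ λ { refl → j′≢j refl })
        (sum-single _ k λ k′ k′≢k → t≈0 i j k′ λ { refl → k′≢k refl }))

⟨$⟩ʳ-injective : ∀ {n} (g : Permutation′ n) {u w} → g ⟨$⟩ʳ u ≡ g ⟨$⟩ʳ w → u ≡ w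
⟨$⟩ʳ-injective g eq = trans (sym (Perm.inverseˡ g)) (trans (cong (g ⟨$⟩ˡ_) eq) (Perm.inverseˡ g))

-- Matrices over an abstract commutative ring.

module _ (K : CommutativeRing 0ℓ 0ℓ) where
  open CommutativeRing K using (Carrier; semiring; _*_)
  open import Algebra.Properties.Semiring.Sum semiring using (sum)

  SquareMatrix : ℕ → Set
  SquareMatrix n = Fin n → Fin n → Carrier

  IsMatrixProduct : (∀ {n} → SquareMatrix n → SquareMatrix n → SquareMatrix n) → Set
  IsMatrixProduct _⊛_ = ∀ {n} (M N : SquareMatrix n) u w →
    (M ⊛ N) u w ≡ sum λ x → M u x * N x w

-- Over the concrete ℂ, conversion checking would unfold the arithmetic down to
-- Cauchy sequences, hence the abstract ring.  For the same reason the matrix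
-- product is a parameter and the lemmas below take matrices together with a
-- description of their entries.
module Matrices (K : CommutativeRing 0ℓ 0ℓ)
  (_⊛_ : ∀ {n} → SquareMatrix K n → SquareMatrix K n → SquareMatrix K n)
  (⊛-entry : IsMatrixProduct K _⊛_) where

  open CommutativeRing K
    renaming (Carrier to 𝕂; refl to ≈-refl; sym to ≈-sym; trans to ≈-trans)
  open SumOverFin +-commutativeMonoid
  open import Algebra.Properties.Semiring.Sum semiring using (sum; sum-cong-≋; sum-permute)
  open import Relation.Binary.Reasoning.Setoid setoid

  private
    Mat : ℕ → Set
    Mat = SquareMatrix K

  ∑ᴹ : ∀ {m n} → (Fin m → Mat n) → Mat n
  ∑ᴹ N u w = sum λ i → N i u w

  ∑ᴹ₃ : ∀ {a b c n} → (Fin a → Fin b → Fin c → Mat n) → Mat n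
  ∑ᴹ₃ N = ∑ᴹ λ i → ∑ᴹ λ j → ∑ᴹ (N i j)

  -- Counterpart of `indicator` over `K`; at `ℂ-commutativeRing` the two agree by definition.
  [_] : ∀ {p} {P : Set p} → Dec P → 𝕂
  [ P? ] = if does P? then 1# else 0#

  []-true : ∀ {p} {P : Set p} (P? : Dec P) → P → [ P? ] ≈ 1#
  []-true (yes _) _ = ≈-refl
  []-true (no ¬p) p = contradiction p ¬p

  []-false : ∀ {p} {P : Set p} (P? : Dec P) → ¬ P → [ P? ] ≈ 0#
  []-false (yes p) ¬p = contradiction p ¬p
  []-false (no _)  _  = ≈-refl

  []-cong : ∀ {p q} {P : Set p} {Q : Set q} (P? : Dec P) (Q? : Dec Q) →
            P ⇔ Q → [ P? ] ≈ [ Q? ]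
  []-cong (yes p) Q? P⇔Q = ≈-sym ([]-true Q? (to P⇔Q p))
  []-cong (no ¬p) Q? P⇔Q = ≈-sym ([]-false Q? (¬p ∘ from P⇔Q))

  []-× : ∀ {p q} {P : Set p} {Q : Set q} (P? : Dec P) (Q? : Dec Q) →
         [ P? ] * [ Q? ] ≈ [ P? ×-dec Q? ]
  []-× (yes _) Q? = *-identityˡ [ Q? ]
  []-× (no _)  Q? = zeroˡ [ Q? ]

  -- Only the summand at `v` survives. Together with `⊛-entryʳ` this evaluates products with
  -- permutation matrices and diagonal matrices.
  ⊛-entryˡ : ∀ {n} (M N : Mat n) u v w → (∀ x → x ≢ v → M u x ≈ 0#) →
             (M ⊛ N) u w ≈ M u v * N v w
  ⊛-entryˡ M N u v w M≈0 = ≈-trans (reflexive (⊛-entry M N u w))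
    (sum-single (λ x → M u x * N x w) v
      λ x x≢v → ≈-trans (*-congʳ (M≈0 x x≢v)) (zeroˡ (N x w)))

  ⊛-entryʳ : ∀ {n} (M N : Mat n) u v w → (∀ x → x ≢ v → N x w ≈ 0#) →
             (M ⊛ N) u w ≈ M u v * N v w
  ⊛-entryʳ M N u v w N≈0 = ≈-trans (reflexive (⊛-entry M N u w))
    (sum-single (λ x → M u x * N x w) v
      λ x x≢v → ≈-trans (*-congˡ (N≈0 x x≢v)) (zeroʳ (M u x)))

  -- Invariance under a permutation as commutation with its matrix.

  Invariant : ∀ {n} → Permutation′ n → Mat n → Set
  Invariant g M = ∀ u w → M (g ⟨$⟩ʳ u) (g ⟨$⟩ʳ w) ≈ M u w

  module _ {n} (g : Permutation′ n) {P : Mat n} (P≈ : ∀ u w → P u w ≈ [ u ≟ g ⟨$⟩ʳ w ])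
           (M : Mat n) where

    private
      -- Row `g u` of `P` has its only 1 in column `u`.
      P⊛M : ∀ u w → (P ⊛ M) (g ⟨$⟩ʳ u) w ≈ M u w
      P⊛M u w = begin
        (P ⊛ M) (g ⟨$⟩ʳ u) w
          ≈⟨ ⊛-entryˡ P M (g ⟨$⟩ʳ u) u w (λ x x≢u → ≈-trans (P≈ (g ⟨$⟩ʳ u) x)
               ([]-false (g ⟨$⟩ʳ u ≟ g ⟨$⟩ʳ x) (x≢u ∘ sym ∘ ⟨$⟩ʳ-injective g))) ⟩
        P (g ⟨$⟩ʳ u) u * M u w
          ≈⟨ *-congʳ (≈-trans (P≈ (g ⟨$⟩ʳ u) u) ([]-true (g ⟨$⟩ʳ u ≟ g ⟨$⟩ʳ u) refl)) ⟩
        1# * M u w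
          ≈⟨ *-identityˡ (M u w) ⟩
        M u w ∎

      -- Column `w` of `P` has its only 1 in row `g w`.
      M⊛P : ∀ u w → (M ⊛ P) u w ≈ M u (g ⟨$⟩ʳ w)
      M⊛P u w = begin
        (M ⊛ P) u w
          ≈⟨ ⊛-entryʳ M P u gw w (λ x x≢gw → ≈-trans (P≈ x w) ([]-false (x ≟ gw) x≢gw)) ⟩
        M u gw * P gw w
          ≈⟨ *-congˡ (≈-trans (P≈ gw w) ([]-true (gw ≟ gw) refl)) ⟩
        M u gw * 1#
          ≈⟨ *-identityʳ (M u gw) ⟩
        M u gw ∎
        where
        gw = g ⟨$⟩ʳ w

    commutes⇒invariant : (∀ u w → (P ⊛ M) u w ≈ (M ⊛ P) u w) → Invariant g M
    commutes⇒invariant comm u w = begin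
      M (g ⟨$⟩ʳ u) (g ⟨$⟩ʳ w)   ≈⟨ M⊛P (g ⟨$⟩ʳ u) w ⟨
      (M ⊛ P) (g ⟨$⟩ʳ u) w      ≈⟨ comm (g ⟨$⟩ʳ u) w ⟨
      (P ⊛ M) (g ⟨$⟩ʳ u) w      ≈⟨ P⊛M u w ⟩
      M u w                     ∎

    invariant⇒commutes : Invariant g M → ∀ u w → (P ⊛ M) u w ≈ (M ⊛ P) u w
    invariant⇒commutes inv u w =
      -- `P⊛M` evaluates rows of the form `g u′` only, so `u` is written as the image of its
      -- preimage.
      subst (λ x → (P ⊛ M) x w ≈ (M ⊛ P) x w) (Perm.inverseʳ g) (begin
        (P ⊛ M) (g ⟨$⟩ʳ u′) w      ≈⟨ P⊛M u′ w ⟩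
        M u′ w                     ≈⟨ inv u′ w ⟨
        M (g ⟨$⟩ʳ u′) (g ⟨$⟩ʳ w)   ≈⟨ M⊛P (g ⟨$⟩ʳ u′) w ⟨
        (M ⊛ P) (g ⟨$⟩ʳ u′) w      ∎)
      where
      u′ = g ⟨$⟩ˡ u

  invariant-≈ : ∀ {n} g (M : Mat n) → Invariant g M → ∀ {u w u′ w′} →
                g ⟨$⟩ʳ u ≡ u′ → g ⟨$⟩ʳ w ≡ w′ → M u w ≈ M u′ w′
  invariant-≈ g M inv {u} {w} refl refl = ≈-sym (inv u w)

  0-invariant : ∀ {n} (g : Permutation′ n) → Invariant g λ _ _ → 0#
  0-invariant g u w = ≈-refl

  1-invariant : ∀ {n} (g : Permutation′ n) → Invariant g λ u w → [ u ≟ w ]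
  1-invariant g u w = []-cong (g ⟨$⟩ʳ u ≟ g ⟨$⟩ʳ w) (u ≟ w)
    (mk⇔ (⟨$⟩ʳ-injective g) (cong (g ⟨$⟩ʳ_)))

  +-invariant : ∀ {n} g (M N : Mat n) → Invariant g M → Invariant g N →
                Invariant g λ u w → M u w + N u w
  +-invariant g M N M-inv N-inv u w = +-cong (M-inv u w) (N-inv u w)

  *ₗ-invariant : ∀ {n} g z (M : Mat n) → Invariant g M → Invariant g λ u w → z * M u w
  *ₗ-invariant g z M M-inv u w = *-congˡ (M-inv u w)

  ⊛-invariant : ∀ {n} g (M N : Mat n) → Invariant g M → Invariant g N → Invariant g (M ⊛ N)
  ⊛-invariant g M N M-inv N-inv u w = begin
    (M ⊛ N) (g ⟨$⟩ʳ u) (g ⟨$⟩ʳ w)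
      ≡⟨ ⊛-entry M N (g ⟨$⟩ʳ u) (g ⟨$⟩ʳ w) ⟩
    sum (λ x → M (g ⟨$⟩ʳ u) x * N x (g ⟨$⟩ʳ w))
      -- As `g` is a bijection, the summation index may be moved by `g` along with `u` and `w`.
      ≈⟨ sum-permute (λ x → M (g ⟨$⟩ʳ u) x * N x (g ⟨$⟩ʳ w)) g ⟩
    sum (λ x → M (g ⟨$⟩ʳ u) (g ⟨$⟩ʳ x) * N (g ⟨$⟩ʳ x) (g ⟨$⟩ʳ w))
      ≈⟨ sum-cong-≋ (λ x → *-cong (M-inv u x) (N-inv x w)) ⟩
    sum (λ x → M u x * N x w)
      ≡⟨ ⊛-entry M N u w ⟨
    (M ⊛ N) u w ∎

  resp-invariant : ∀ {n} g (M N : Mat n) → (∀ u w → M u w ≈ N u w) →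
                   Invariant g M → Invariant g N
  resp-invariant g M N M≈N M-inv u w =
    ≈-trans (≈-sym (M≈N (g ⟨$⟩ʳ u) (g ⟨$⟩ʳ w))) (≈-trans (M-inv u w) (M≈N u w))

  -- The left diagonal factor masks rows and the right one masks columns. Applied to `E* i`, `A j`,
  -- `E* k`, this gives the generators of `T₀`.
  corner-entry : ∀ {n} {P : Fin n → Set} {Q : Fin n → Fin n → Set} {R : Fin n → Set}
    (P? : ∀ u → Dec (P u)) (Q? : ∀ u w → Dec (Q u w)) (R? : ∀ w → Dec (R w))
    {D B E : Mat n} →
    (∀ u w → D u w ≈ [ u ≟ w ×-dec P? u ]) →
    (∀ u w → B u w ≈ [ Q? u w ]) →
    (∀ u w → E u w ≈ [ u ≟ w ×-dec R? u ]) →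
    ∀ u w → ((D ⊛ B) ⊛ E) u w ≈ [ P? u ×-dec Q? u w ×-dec R? w ]
  corner-entry {n} P? Q? R? {D} {B} {E} D≈ B≈ E≈ u w = begin
    ((D ⊛ B) ⊛ E) u w
      ≈⟨ ⊛-entryʳ (D ⊛ B) E u w w (λ x → off R? E≈ x w) ⟩
    (D ⊛ B) u w * E w w
      ≈⟨ *-cong (⊛-entryˡ D B u u w λ x x≢u → off P? D≈ u x (x≢u ∘ sym)) (on R? E≈ w) ⟩
    D u u * B u w * [ R? w ]
      ≈⟨ *-congʳ (*-cong (on P? D≈ u) (B≈ u w)) ⟩
    [ P? u ] * [ Q? u w ] * [ R? w ]
      ≈⟨ *-assoc [ P? u ] [ Q? u w ] [ R? w ] ⟩
    [ P? u ] * ([ Q? u w ] * [ R? w ])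
      ≈⟨ *-congˡ ([]-× (Q? u w) (R? w)) ⟩
    [ P? u ] * [ Q? u w ×-dec R? w ]
      ≈⟨ []-× (P? u) (Q? u w ×-dec R? w) ⟩
    [ P? u ×-dec Q? u w ×-dec R? w ] ∎
    where
    module _ {S : Fin n → Set} (S? : ∀ u → Dec (S u)) {F : Mat n}
             (F≈ : ∀ u w → F u w ≈ [ u ≟ w ×-dec S? u ]) where
      off : ∀ u w → u ≢ w → F u w ≈ 0#
      off u w u≢w = ≈-trans (F≈ u w) ([]-false (u ≟ w ×-dec S? u) (u≢w ∘ proj₁))

      on : ∀ u → F u u ≈ [ S? u ]
      on u = ≈-trans (F≈ u u) ([]-cong (u ≟ u ×-dec S? u) (S? u) (mk⇔ proj₂ (refl ,_)))

  -- Matrices constant on types, as combinations of indicator matrices.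

  module _ {n} {T : Set} {_⊢_↝_ : T → Fin n → Fin n → Set}
           (type? : ∀ t u w → Dec (t ⊢ u ↝ w)) (M : Mat n)
           (M-const : ∀ t {u w u′ w′} → t ⊢ u ↝ w → t ⊢ u′ ↝ w′ → M u w ≈ M u′ w′) where

    private
      -- The decision is an argument so that `entry-≈` can match on it.
      entry : ∀ {t} → Dec (∃₂ (t ⊢_↝_)) → 𝕂
      entry (yes (u , w , _)) = M u w
      entry (no _)            = 0#

      -- The pair stored in the decision may differ from `(u , w)`, but has the same type, so
      -- `M-const` applies.
      entry-≈ : ∀ {t} (e? : Dec (∃₂ (t ⊢_↝_))) {u w} → t ⊢ u ↝ w → entry e? ≈ M u w
      entry-≈ {t} (yes (_ , _ , t⊢)) t⊢′ = M-const t t⊢ t⊢′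
      entry-≈ (no ∄) {u} {w} t⊢        = contradiction (u , w , t⊢) ∄

      occurs? : ∀ t → Dec (∃₂ (t ⊢_↝_))
      occurs? t = any? λ u → any? λ w → type? t u w

    -- 0 if no pair has type t.
    coefficient : T → 𝕂
    coefficient t = entry (occurs? t)

    coefficient-on : ∀ t u w → t ⊢ u ↝ w → coefficient t * [ type? t u w ] ≈ M u w
    coefficient-on t u w t⊢ =
      ≈-trans (*-cong (entry-≈ (occurs? t) t⊢) ([]-true (type? t u w) t⊢)) (*-identityʳ (M u w))

    coefficient-off : ∀ t u w → ¬ (t ⊢ u ↝ w) → coefficient t * [ type? t u w ] ≈ 0#
    coefficient-off t u w t⊬ =
      ≈-trans (*-congˡ ([]-false (type? t u w) t⊬)) (zeroʳ (coefficient t))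

  -- Each pair has exactly one type, so at each entry only the term of that type survives, and its
  -- coefficient is the value of `M` there.
  decomposition : ∀ {n a b c} {_⊢_↝_ : Fin a × Fin b × Fin c → Fin n → Fin n → Set}
    (type? : ∀ t u w → Dec (t ⊢ u ↝ w)) (M : Mat n)
    (M-const : ∀ t {u w u′ w′} → t ⊢ u ↝ w → t ⊢ u′ ↝ w′ → M u w ≈ M u′ w′)
    (type : Fin n → Fin n → Fin a × Fin b × Fin c) →
    (∀ u w → type u w ⊢ u ↝ w) → (∀ {t u w} → t ⊢ u ↝ w → t ≡ type u w) →
    (C : Fin a → Fin b → Fin c → Mat n) →
    (∀ i j k u w → C i j k u w ≈
      coefficient type? M M-const (i , j , k) * [ type? (i , j , k) u w ]) →
    ∀ u w → ∑ᴹ₃ C u w ≈ M u w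
  decomposition type? M M-const type typed unique C C≈ u w = ≈-trans
    (sum-single₃ (λ i j k → C i j k u w) _ _ _ λ i j k t≢ → ≈-trans (C≈ i j k u w)
      (coefficient-off type? M M-const (i , j , k) u w (t≢ ∘ unique)))
    (≈-trans (C≈ _ _ _ u w) (coefficient-on type? M M-const (type u w) u w (typed u w)))

-- Spans and generated algebras of complex matrices.

*ᴹ-entry : IsMatrixProduct ℂ-commutativeRing _*ᴹ_
*ᴹ-entry M N u w = refl

open Matrices ℂ-commutativeRing _*ᴹ_ *ᴹ-entry

module _ {n : ℕ} where

  -- The matrices invariant under `g` form an algebra, so the generators decide.
  Alg-invariant : ∀ (g : Permutation′ n) {I : Set} {M : I → Matrix n} →
    (∀ i → Invariant g (M i)) → ∀ {N} → N ∈ Alg M → Invariant g N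
  Alg-invariant g M-inv (generator i)             = M-inv i
  Alg-invariant g M-inv 0-closed                  = 0-invariant g
  Alg-invariant g M-inv 1-closed                  = 1-invariant g
  Alg-invariant g M-inv (+-closed {N} {P} N∈ P∈)  =
    +-invariant g N P (Alg-invariant g M-inv N∈) (Alg-invariant g M-inv P∈)
  Alg-invariant g M-inv (*-closed {N} {P} N∈ P∈)  =
    ⊛-invariant g N P (Alg-invariant g M-inv N∈) (Alg-invariant g M-inv P∈)
  Alg-invariant g M-inv (*ₗ-closed z {N} N∈)      =
    *ₗ-invariant g z N (Alg-invariant g M-inv N∈)
  Alg-invariant g M-inv (resp {N} {P} N≈P N∈)     =
    resp-invariant g N P N≈P (Alg-invariant g M-inv N∈)

  permutationMatrix-entry : ∀ (g : Permutation′ n) u w →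
    permutationMatrix g u w ℂ.≈ indicator (u ≟ g ⟨$⟩ʳ w)
  permutationMatrix-entry g u w = ℂ.refl {permutationMatrix g u w}

  Span⊆Alg : ∀ {I J : Set} {M : I → Matrix n} {N : J → Matrix n} →
    (∀ i → M i ∈ Alg N) → Span M ⊆ Alg N
  Span⊆Alg M⊆ (generator i)     = M⊆ i
  Span⊆Alg M⊆ 0-closed          = 0-closed
  Span⊆Alg M⊆ (+-closed N∈ P∈)  = +-closed (Span⊆Alg M⊆ N∈) (Span⊆Alg M⊆ P∈)
  Span⊆Alg M⊆ (*ₗ-closed z N∈)  = *ₗ-closed z (Span⊆Alg M⊆ N∈)
  Span⊆Alg M⊆ (resp N≈P N∈)     = resp N≈P (Span⊆Alg M⊆ N∈)

  sum-closed : ∀ {I : Set} {M : I → Matrix n} {m} (N : Fin m → Matrix n) →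
    (∀ i → N i ∈ Span M) → ∑ᴹ N ∈ Span M
  sum-closed {m = 0}     N N∈ = 0-closed
  sum-closed {m = suc m} N N∈ = +-closed (N∈ zero) (sum-closed (N ∘ suc) (N∈ ∘ suc))

  sum₃-closed : ∀ {I : Set} {M : I → Matrix n} {a b c}
    (N : Fin a → Fin b → Fin c → Matrix n) →
    (∀ i j k → N i j k ∈ Span M) → ∑ᴹ₃ N ∈ Span M
  sum₃-closed {M = M} N N∈ =
    sum-closed {M = M} (λ i → ∑ᴹ λ j → ∑ᴹ (N i j)) λ i →
      sum-closed {M = M} (λ j → ∑ᴹ (N i j)) λ j → sum-closed (N i j) (N∈ i j)

-- The algebras `T₀`, `T` and `T̃` of a scheme.

module Scheme {n : ℕ} (X : AssociationScheme n) where
  open AssociationScheme X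

  index : Fin n → Fin n → Fin (suc d)
  index u w = proj₁ (partition u w)

  R-index : ∀ u w → R (index u w) u w
  R-index u w = proj₁ (proj₂ (partition u w))

  index-unique : ∀ {i u w} → R i u w → i ≡ index u w
  index-unique {u = u} {w} r = sym (proj₂ (proj₂ (partition u w)) r)

  A-invariant : ∀ {g} → g ∈ᴳ Aut X → ∀ i → Invariant g (A X i)
  A-invariant {g} g∈ i u w =
    []-cong (R? i (g ⟨$⟩ʳ u) (g ⟨$⟩ʳ w)) (R? i u w) (⇔-sym (g∈ i u w))

  module At (v : Fin n) where

    -- Since `g` fixes `v`, it carries the pair `(v , u)` to `(v , g u)` within the same relation.
    E*-invariant : ∀ {g} → g ∈ᴳ Stabilizer (Aut X) v → ∀ i → Invariant g (E* X v i)
    E*-invariant {g} (g∈ , gv≡v) i u w =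
      []-cong (g ⟨$⟩ʳ u ≟ g ⟨$⟩ʳ w ×-dec R? i v (g ⟨$⟩ʳ u)) (u ≟ w ×-dec R? i v u)
        (mk⇔
          (λ (eq , r) → ⟨$⟩ʳ-injective g eq ,
            from (g∈ i v u) (subst (λ x → R i x (g ⟨$⟩ʳ u)) (sym gv≡v) r))
          (λ (eq , r) → cong (g ⟨$⟩ʳ_) eq ,
            subst (λ x → R i x (g ⟨$⟩ʳ u)) gv≡v (to (g∈ i v u) r)))

    T₀⊆T : T₀ X v ⊆ T X v
    T₀⊆T = Span⊆Alg λ (i , j , k) → *-closed
      {N = E* X v i *ᴹ A X j} {P = E* X v k}
      (*-closed {N = E* X v i} {P = A X j} (generator (inj₂ i)) (generator (inj₁ j)))
      (generator (inj₂ k))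

    T⊆T̃ : T X v ⊆ T̃ X v
    T⊆T̃ {M} M∈T g g∈@(g∈Aut , _) =
      invariant⇒commutes g {permutationMatrix g} (permutationMatrix-entry g) M
        (Alg-invariant g generators {M} M∈T)
      where
      generators : ∀ i → Invariant g (Sum.[ A X , E* X v ] i)
      generators (inj₁ i) = A-invariant {g} g∈Aut i
      generators (inj₂ i) = E*-invariant {g} g∈ i

    T̃-invariant : ∀ M → M ∈ T̃ X v → ∀ g → g ∈ᴳ Stabilizer (Aut X) v → Invariant g M
    T̃-invariant M M∈T̃ g g∈ =
      commutes⇒invariant g {permutationMatrix g} (permutationMatrix-entry g) M (M∈T̃ g g∈)

    -- These are the types fed to `decomposition`: `block t` is the indicator matrix of
    -- `Triangle t`.
    Triangle : Fin (suc d) × Fin (suc d) × Fin (suc d) → Fin n → Fin n → Set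
    Triangle (i , j , k) u w = R i v u × R j u w × R k v w

    Triangle? : ∀ t u w → Dec (Triangle t u w)
    Triangle? (i , j , k) u w = R? i v u ×-dec R? j u w ×-dec R? k v w

    block : Fin (suc d) × Fin (suc d) × Fin (suc d) → Matrix n
    block (i , j , k) = E* X v i *ᴹ A X j *ᴹ E* X v k

    triangle : Fin n → Fin n → Fin (suc d) × Fin (suc d) × Fin (suc d)
    triangle u w = index v u , index u w , index v w

    Triangle-triangle : ∀ u w → Triangle (triangle u w) u w
    Triangle-triangle u w = R-index v u , R-index u w , R-index v w

    triangle-unique : ∀ {t u w} → Triangle t u w → t ≡ triangle u w
    triangle-unique (r , r′ , r″)
      with refl ← index-unique r | refl ← index-unique r′ | refl ← index-unique r″ = refl

    ConstantOnTriangles : Matrix n → Set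
    ConstantOnTriangles M = ∀ t {u w u′ w′} → Triangle t u w → Triangle t u′ w′ →
      M u w ℂ.≈ M u′ w′

    E*-entry : ∀ i u w → E* X v i u w ℂ.≈ indicator (u ≟ w ×-dec R? i v u)
    E*-entry i u w = ℂ.refl {E* X v i u w}

    A-entry : ∀ j u w → A X j u w ℂ.≈ indicator (R? j u w)
    A-entry j u w = ℂ.refl {A X j u w}

    block-entry : ∀ t u w → block t u w ℂ.≈ indicator (Triangle? t u w)
    block-entry (i , j , k) =
      corner-entry (R? i v) (R? j) (R? k v) {E* X v i} {A X j} {E* X v k}
        (E*-entry i) (A-entry j) (E*-entry k)

    module _ (M : Matrix n) (M-const : ConstantOnTriangles M) where

      private
        coeff : Fin (suc d) × Fin (suc d) × Fin (suc d) → ℂ.Carrier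
        coeff = coefficient Triangle? M M-const

        term : Fin (suc d) → Fin (suc d) → Fin (suc d) → Matrix n
        term i j k = coeff (i , j , k) *ₗ block (i , j , k)

        term-entry : ∀ i j k u w →
          term i j k u w ℂ.≈ coeff (i , j , k) ℂ.* indicator (Triangle? (i , j , k) u w)
        term-entry i j k u w =
          ℂ.*-congˡ {coeff (i , j , k)} {block (i , j , k) u w}
            {indicator (Triangle? (i , j , k) u w)} (block-entry (i , j , k) u w)

        terms-sum : ∑ᴹ₃ term ≈ᴹ M
        terms-sum = decomposition {_⊢_↝_ = Triangle} Triangle? M M-const
          triangle Triangle-triangle triangle-unique term term-entry

        terms-closed : ∑ᴹ₃ term ∈ T₀ X v
        terms-closed = sum₃-closed term λ i j k →
          *ₗ-closed (coeff (i , j , k)) {block (i , j , k)} (generator (i , j , k))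

      -- Reduces membership in `T₀` to comparing entries at pairs of the same type.
      constantOnTriangles⇒T₀ : M ∈ T₀ X v
      constantOnTriangles⇒T₀ = resp {N = ∑ᴹ₃ term} {P = M} terms-sum terms-closed

-- Orbitals, and the pigeonhole principle in a finite group.

module _ {n : ℕ} (G : Subgroup n) where

  private module G = Subgroup G

  Orbital-connect : ∀ {a b u w u′ w′} → Orbital G a b u w → Orbital G a b u′ w′ →
                    Orbital G u w u′ w′
  Orbital-connect (g , g∈ , refl , refl) (h , h∈ , refl , refl) =
    -- `_∘ₚ_` applies its left factor first: back to `(a , b)` by the inverse of `g`, then on by
    -- `h`.
    Perm.flip g ∘ₚ h , G.∘-closed (G.⁻¹-closed g∈) h∈ ,
    cong (h ⟨$⟩ʳ_) (Perm.inverseˡ g) , cong (h ⟨$⟩ʳ_) (Perm.inverseˡ g)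

  Orbital-step : ∀ {a b u w g} → g ∈ᴳ G → Orbital G a b u w →
                 Orbital G a b (g ⟨$⟩ʳ u) (g ⟨$⟩ʳ w)
  Orbital-step {g = g} g∈ (h , h∈ , refl , refl) = h ∘ₚ g , G.∘-closed h∈ g∈ , refl , refl

  module _ (X : AssociationScheme n) (orb : IsOrbitalScheme G X) where
    open AssociationScheme X

    R⇒Orbital : ∀ {i u w u′ w′} → R i u w → R i u′ w′ → Orbital G u w u′ w′
    R⇒Orbital {i} r r′ with a , b , R≈ ← proj₁ orb i =
      Orbital-connect (to (R≈ _ _) r) (to (R≈ _ _) r′)

    -- Orbitals are stable under `G`; the backward implication uses the inverse of `g`. This makes
    -- elements of the stabilizer in `G` available for testing matrices in `T̃`.
    ≤Aut : G ≤ᴳ Aut X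
    ≤Aut {g} g∈ i u w with a , b , R≈ ← proj₁ orb i = mk⇔
      (λ r → from (R≈ _ _) (Orbital-step g∈ (to (R≈ _ _) r)))
      (λ r → subst₂ (R i) (Perm.inverseˡ g) (Perm.inverseˡ g)
        (from (R≈ _ _) (Orbital-step (G.⁻¹-closed g∈) (to (R≈ _ _) r))))

  coincide : ∀ {k} → HasOrder G k → (f : Fin (suc k) → ∃ (_∈ᴳ G)) →
    ∃₂ λ i j → i < j × proj₁ (f i) Perm.≈ proj₁ (f j)
  -- Here `≤-refl` proves `k < suc k`.
  coincide order f = conclude (pigeonhole ≤-refl (Order.from ∘ f))
    where
    module Order = Inverse order

    conclude : (∃₂ λ i j → i < j × Order.from (f i) ≡ Order.from (f j)) →
      ∃₂ λ i j → i < j × proj₁ (f i) Perm.≈ proj₁ (f j)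
    conclude (i , j , i<j , eq) = i , j , i<j , λ x →
      trans (sym (Order.strictlyInverseˡ (f i) x))
        (trans (cong (λ k → proj₁ (Order.to k) ⟨$⟩ʳ x) eq) (Order.strictlyInverseˡ (f j) x))

-- Conjugating triangles by means of the regular subgroup.

module _ {n : ℕ} (G R : Subgroup n) (R≤G : R ≤ᴳ G) (regular : Regular R) where

  private
    module G = Subgroup G
    module R = Subgroup R

  -- Both `r` and the identity are elements of `R` taking `x` to `x`, and regularity allows only
  -- one.
  fixes⇒id : ∀ {r x} → r ∈ᴳ R → r ⟨$⟩ʳ x ≡ x → r Perm.≈ Perm.id
  fixes⇒id {x = x} r∈ rx≡x y with _ , _ , unique ← regular x x =
    trans (sym (unique (r∈ , rx≡x) y)) (unique (R.id-closed , refl) y)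

  triangles-conjugate : ∀ {v u w u′ w′} → HasOrder (Stabilizer G v) 2 →
    Orbital G v u v u′ → Orbital G u w u′ w′ → Orbital G v w v w′ →
    ∃ λ g → g ∈ᴳ Stabilizer G v × g ⟨$⟩ʳ u ≡ u′ × g ⟨$⟩ʳ w ≡ w′
  triangles-conjugate {v} order
    (a , a∈ , av≡v , au≡u′) (c , c∈ , cu≡u′ , cw≡w′) (b , b∈ , bv≡v , bw≡w′)
    with r , (r∈ , rv≡cv) , _ ← regular v (c ⟨$⟩ʳ v)
    = conclude (coincide (Stabilizer G v) order candidates)
    where
    h : Permutation′ n
    h = c ∘ₚ Perm.flip r

    candidates : Fin 3 → ∃ (_∈ᴳ Stabilizer G v)
    candidates 0F = a , a∈ , av≡v
    candidates 1F = b , b∈ , bv≡v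
    -- `c` sends `v` to `c v = r v`, and the inverse of `r` brings it back.
    candidates 2F = h , G.∘-closed c∈ (G.⁻¹-closed (R≤G r∈)) ,
      trans (cong (r ⟨$⟩ˡ_) (sym rv≡cv)) (Perm.inverseˡ r)

    -- From `c = r h` as maps, `r` fixes `y`, so `r` is the identity and `c v = r v = v`.
    c-fixes-v : ∀ {x y} → c ⟨$⟩ʳ x ≡ y → h ⟨$⟩ʳ x ≡ y → c ⟨$⟩ʳ v ≡ v
    c-fixes-v cx≡y hx≡y = trans (sym rv≡cv)
      (fixes⇒id r∈ (trans (cong (r ⟨$⟩ʳ_) (sym hx≡y)) (trans (Perm.inverseʳ r) cx≡y)) v)

    conclude : (∃₂ λ i j → i < j × proj₁ (candidates i) Perm.≈ proj₁ (candidates j)) →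
      ∃ λ g → g ∈ᴳ Stabilizer G v × g ⟨$⟩ʳ _ ≡ _ × g ⟨$⟩ʳ _ ≡ _
    conclude (0F , 1F , _ , a≈b) = a , (a∈ , av≡v) , au≡u′ , trans (a≈b _) bw≡w′
    -- `c` already moves `u` and `w` correctly, so only `c v = v` is at stake here and in the next
    -- case.
    conclude (0F , 2F , _ , a≈h) =
      c , (c∈ , c-fixes-v cu≡u′ (trans (sym (a≈h _)) au≡u′)) , cu≡u′ , cw≡w′
    conclude (1F , 2F , _ , b≈h) =
      c , (c∈ , c-fixes-v cw≡w′ (trans (sym (b≈h _)) bw≡w′)) , cu≡u′ , cw≡w′
    -- The remaining index pairs contradict `i < j`.
    conclude (suc _ , 1F , s<s () , _)
    conclude (2F , 2F , s<s (s<s ()) , _)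

theorem1p3 : ∀ (n : ℕ) (G : Subgroup n) →
    Transitive G →
    (∀ (v : Fin n) → HasOrder (Stabilizer G v) 2) →
    (R : Subgroup n) → R ≤ᴳ G → Regular R →
    (X : AssociationScheme n) → IsOrbitalScheme G X →
    TriplyTransitive X
theorem1p3 n G transitive order R R≤G regular X orb =
  (λ u w → let g , g∈ , gu≡w = transitive u w in g , ≤Aut G X orb g∈ , gu≡w) ,
  -- Both equalities follow from the cycle of inclusions `T₀ ⊆ T ⊆ T̃ ⊆ T₀`.
  λ v → ((λ {M} → T₀⊆T v {M}) , λ {M} M∈T → T̃⊆T₀ v {M} (T⊆T̃ v {M} M∈T)) ,
        ((λ {M} → T⊆T̃ v {M}) , λ {M} M∈T̃ → T₀⊆T v {M} (T̃⊆T₀ v {M} M∈T̃))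
  where
  open Scheme.At X

  T̃⊆T₀ : ∀ v → T̃ X v ⊆ T₀ X v
  T̃⊆T₀ v {M} M∈T̃ = constantOnTriangles⇒T₀ v M M-const
    where
    M-const : ConstantOnTriangles v M
    -- Corresponding sides of the triangles on `v`, `u`, `w` and `v`, `u′`, `w′` lie in the same
    -- orbital, so some `g` fixing `v` carries one triangle to the other, and `M` is invariant under
    -- it.
    M-const t {u} {w} {u′} {w′} (r₁ , r₂ , r₃) (s₁ , s₂ , s₃) =
      let g , (g∈ , gv≡v) , gu≡u′ , gw≡w′ = triangles-conjugate G R R≤G regular (order v)
            (R⇒Orbital G X orb r₁ s₁) (R⇒Orbital G X orb r₂ s₂) (R⇒Orbital G X orb r₃ s₃)
      in invariant-≈ g M (T̃-invariant v M M∈T̃ g (≤Aut G X orb g∈ , gv≡v)) gu≡u′ gw≡w′
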